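{- For every $n\ge 1$, $$\sum_{\sigma\in\mathcal{S}_n(132)}a^{\operatorname{des}(\sigma)}q^{\operatorname{maj}(\sigma)}t^{\operatorname{imaj}(\sigma)}=\sum_{\sigma\in\mathcal{S}_n(213)}a^{n-1-\operatorname{des}(\sigma)}q^{\binom{n}{2}-\operatorname{maj}(\sigma)}t^{\binom{n}{2}-\operatorname{imaj}(\sigma)}$$ as polynomials in the indeterminates $a,q,t$.
   Context: $\mathcal{S}_n$ is the symmetric group on $\{1,\dots,n\}$. $\mathcal{S}_n(132)$ is the set of $\sigma\in\mathcal{S}_n$ with no $i<j<k$ satisfying $\sigma_i<\sigma_k<\sigma_j$; $\mathcal{S}_n(213)$ is the set of $\sigma\in\mathcal{S}_n$ with no $i<j<k$ satisfying $\sigma_j<\sigma_i<\sigma_k$. The descent set is $\operatorname{Des}(\sigma)=\{i : 1\le i<n,\ \sigma_i>\sigma_{i+1}\}$, $\operatorname{des}(\sigma)=|\operatorname{Des}(\sigma)|$, $\operatorname{maj}(\sigma)=\sum_{i\in\operatorname{Des}(\sigma)}i$, and $\operatorname{imaj}(\sigma)=\operatorname{maj}(\sigma^{ -1})$. -}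

module Defs where

open import Data.Fin.Base as Fin using (Fin; zero; suc; inject₁; toℕ)
import Data.Fin.Properties as Fin
import Data.Fin.Permutation as Perm
open import Data.Fin.Permutation using (Permutation′; _⟨$⟩ʳ_; flip; insert; remove)
open import Data.Integer.Base as ℤ using (ℤ; 0ℤ; 1ℤ)
open import Data.List.Base
  using (List; []; _∷_; _++_; allFin; cartesianProductWith; filter; foldr; length; map)
open import Data.List.Membership.Propositional.Properties using (∈-allFin)
open import Data.List.Relation.Unary.All as All using (All)
import Data.List.Relation.Unary.All.Properties as All
open import Data.List.Relation.Unary.AllPairs as AllPairs using (AllPairs; []; _∷_)
import Data.List.Relation.Unary.AllPairs.Properties as AllPairs
open import Data.List.Relation.Unary.Any using (Any; here)
import Data.List.Relation.Unary.Any.Properties as Any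
open import Data.List.Relation.Unary.Unique.Propositional using (Unique)
open import Data.List.Relation.Unary.Unique.Propositional.Properties using (allFin⁺)
open import Data.Nat.Base as ℕ using (ℕ; zero; suc; pred)
open import Data.Nat.ListAction using (sum)
import Data.Nat.Properties as ℕ
open import Data.Product.Base using (_×_; _,_; proj₂; ∃-syntax)
import Data.Product.Properties as Product
open import Function.Base using (_∘_)
open import Relation.Binary.Definitions using (DecidableEquality)
open import Relation.Binary.PropositionalEquality using (_≡_; _≢_; refl; sym; trans; cong)
open import Relation.Nullary.Decidable using (yes; no; ¬?; _×-dec_)
open import Relation.Nullary.Negation using (¬_)
open import Relation.Unary using (Decidable)

-- The exponents of a, q and t, in this order.
Monomial : Set
Monomial = ℕ × ℕ × ℕ

_≟ₘ_ : DecidableEquality Monomial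
_≟ₘ_ = Product.≡-dec ℕ._≟_ (Product.≡-dec ℕ._≟_ ℕ._≟_)

_·ₘ_ : Monomial → Monomial → Monomial
(i , j , k) ·ₘ (i′ , j′ , k′) = i ℕ.+ i′ , j ℕ.+ j′ , k ℕ.+ k′

-- A polynomial is represented by a finite formal sum of terms, in which a
-- monomial may occur repeatedly; _≈_ below is the equality of polynomials.
Polynomial : Set
Polynomial = List (ℤ × Monomial)

coeff : Polynomial → Monomial → ℤ
coeff []            m = 0ℤ
coeff ((c , m′) ∷ p) m with m′ ≟ₘ m
... | yes _ = c ℤ.+ coeff p m
... | no  _ = coeff p m

infix  4 _≈_
infixl 6 _+_
infixl 7 _*_
infixr 8 _^_

_≈_ : Polynomial → Polynomial → Set
p ≈ r = ∀ m → coeff p m ≡ coeff r m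

0ₚ 1ₚ a q t : Polynomial
0ₚ = []
1ₚ = (1ℤ , 0 , 0 , 0) ∷ []
a  = (1ℤ , 1 , 0 , 0) ∷ []
q  = (1ℤ , 0 , 1 , 0) ∷ []
t  = (1ℤ , 0 , 0 , 1) ∷ []

_+_ _*_ : Polynomial → Polynomial → Polynomial
p + r = p ++ r
p * r = cartesianProductWith (λ (c , m) (d , m′) → c ℤ.* d , m ·ₘ m′) p r

_^_ : Polynomial → ℕ → Polynomial
p ^ zero  = 1ₚ
p ^ suc n = p * p ^ n

∑ : {A : Set} → List A → (A → Polynomial) → Polynomial
∑ xs f = foldr (λ x p → f x + p) 0ₚ xs

-- A permutation of {0,…,n} is determined by the image of 0 and by the
-- permutation of the remaining n points, standardised.
permutations : ∀ n → List (Permutation′ n)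
permutations zero    = Perm.id ∷ []
permutations (suc n) = cartesianProductWith (insert zero) (allFin (suc n)) (permutations n)

private
  variable
    n : ℕ

insert-cong : ∀ j {π ρ : Permutation′ n} → π Perm.≈ ρ →
              insert zero j π Perm.≈ insert zero j ρ
insert-cong j π≈ρ zero    = refl
insert-cong j π≈ρ (suc k) = cong (Fin.punchIn j) (π≈ρ k)

insert-injective : ∀ {i j} {π ρ : Permutation′ n} →
                   insert zero i π Perm.≈ insert zero j ρ → i ≡ j × π Perm.≈ ρ
insert-injective {i = i} eq with refl ← eq zero =
  refl , λ k → Fin.punchIn-injective i _ _ (eq (suc k))

-- permutations-complete and permutations-unique: every permutation occurs in
-- the list exactly once, permutations being compared pointwise.
permutations-complete : (σ : Permutation′ n) → Any (σ Perm.≈_) (permutations n)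
permutations-complete {zero}  σ = here λ ()
permutations-complete {suc n} σ =
  Any.cartesianProductWith⁺ (insert zero)
    (λ { {_} {π} refl eq k → trans (sym (Perm.insert-remove zero σ k))
                                   (insert-cong (σ ⟨$⟩ʳ zero) {ρ = π} eq k) })
    (∈-allFin (σ ⟨$⟩ʳ zero)) (permutations-complete (remove zero σ))

permutations-unique : ∀ n → AllPairs (λ σ τ → ¬ σ Perm.≈ τ) (permutations n)
permutations-unique zero    = All.[] ∷ []
permutations-unique (suc n) = go (allFin⁺ (suc n))
  where
  go : ∀ {js} → Unique js →
       AllPairs (λ σ τ → ¬ σ Perm.≈ τ) (cartesianProductWith (insert zero) js (permutations n))
  go []         = []
  go {j ∷ js} (j∉js ∷ js!) = AllPairs.++⁺
    (AllPairs.map⁺ (AllPairs.map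
      (λ {π} {ρ} π≉ρ eq → π≉ρ (proj₂ (insert-injective {π = π} {ρ} eq)))
      (permutations-unique n)))
    (go js!)
    (All.map⁺ (All.universal (λ π → others π j∉js) (permutations n)))
    where
    others : ∀ π {is} → All (j ≢_) is →
             All (λ τ → ¬ insert zero j π Perm.≈ τ)
                 (cartesianProductWith (insert zero) is (permutations n))
    others π All.[]           = All.[]
    others π (j≢i All.∷ j∉is) = All.++⁺
      (All.map⁺ (All.universal (λ ρ eq → j≢i (eq zero)) (permutations n)))
      (others π j∉is)

Contains132 Contains213 : Permutation′ n → Set
Contains132 σ = ∃[ i ] ∃[ j ] ∃[ k ] i Fin.< j × j Fin.< k ×
  (σ ⟨$⟩ʳ i) Fin.< (σ ⟨$⟩ʳ k) × (σ ⟨$⟩ʳ k) Fin.< (σ ⟨$⟩ʳ j)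
Contains213 σ = ∃[ i ] ∃[ j ] ∃[ k ] i Fin.< j × j Fin.< k ×
  (σ ⟨$⟩ʳ j) Fin.< (σ ⟨$⟩ʳ i) × (σ ⟨$⟩ʳ i) Fin.< (σ ⟨$⟩ʳ k)

avoids132? : Decidable λ (σ : Permutation′ n) → ¬ Contains132 σ
avoids132? σ = ¬? (Fin.any? λ i → Fin.any? λ j → Fin.any? λ k →
  i Fin.<? j ×-dec j Fin.<? k ×-dec
  (σ ⟨$⟩ʳ i) Fin.<? (σ ⟨$⟩ʳ k) ×-dec (σ ⟨$⟩ʳ k) Fin.<? (σ ⟨$⟩ʳ j))

avoids213? : Decidable λ (σ : Permutation′ n) → ¬ Contains213 σ
avoids213? σ = ¬? (Fin.any? λ i → Fin.any? λ j → Fin.any? λ k →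
  i Fin.<? j ×-dec j Fin.<? k ×-dec
  (σ ⟨$⟩ʳ j) Fin.<? (σ ⟨$⟩ʳ i) ×-dec (σ ⟨$⟩ʳ i) Fin.<? (σ ⟨$⟩ʳ k))

𝒮₁₃₂ 𝒮₂₁₃ : ∀ n → List (Permutation′ n)
𝒮₁₃₂ n = filter avoids132? (permutations n)
𝒮₂₁₃ n = filter avoids213? (permutations n)

-- Positions are counted from 0 here, so that i : Fin (n - 1) stands for the
-- position i + 1 ∈ {1,…,n-1}; maj adds the 1 back.
Des : Permutation′ n → List (Fin (pred n))
Des {zero}  σ = []
Des {suc n} σ = filter (λ i → (σ ⟨$⟩ʳ suc i) Fin.<? (σ ⟨$⟩ʳ inject₁ i)) (allFin n)

des maj imaj : Permutation′ n → ℕ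
des  σ = length (Des σ)
maj  σ = sum (map (suc ∘ toℕ) (Des σ))
imaj σ = maj (flip σ)

{-# OPTIONS --safe #-}
module Submission where

-- Why the theorem holds.  A permutation σ of {1,…,n} is recorded by a word of
-- n - 1 steps, the i-th of which consists of two bits: whether i is a descent
-- of σ, and whether n - i is a descent of σ⁻¹.  The word determines des, maj
-- and imaj.  Read the step (1,0) as up, (0,1) as down, and (0,0) and (1,1) as
-- level steps of two colours.  Then σ ↦ word σ is a bijection from the
-- 132-avoiding permutations onto the Motzkin paths with level steps of two
-- colours (word-path, word-surjective, word-injective).
--
-- This is an induction on n that removes the first entry of σ.  Let that entry
-- be j and let the rest, standardised, be π.  Then σ avoids 132 if and only if
-- π does and the first entry of π is at most j (avoids132-first,
-- avoids132-extend).  In that case word σ depends on j and word π only: if j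
-- equals the first entry of π, a step (0,0) is put in front (word-level).
-- Otherwise a 1 is put in front of the first row and a 1 is inserted into the
-- initial run of zeros of the second row, at a place that encodes j
-- (word-graft).  The number of leading zeros of the second row of word σ gives
-- j back (lead-word), so both operations can be undone, and they translate into
-- an equally recursive description of the paths (path-graft, path-prune).
--
-- The reflection of permutation diagrams in the anti-diagonal exchanges 132 and
-- 213 and exchanges the two rows of a word (word-antitranspose).  Negating
-- every bit of the word of a 213-avoiding τ therefore gives the word of a
-- 132-avoiding permutation with its two level colours exchanged
-- (dual-antitranspose).  Exchanging the level colours preserves the set of
-- paths.  So the words of the 132-avoiders and the negated words of the
-- 213-avoiders are the same list up to order (words-↭).  Negation replaces the
-- descent sets of τ and of τ⁻¹ by their complements in {1,…,n-1}, which yields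
-- the exponents on the right-hand side (exponents-complement).

open import Defs
open import Data.Nat.Base using (ℕ; _∸_; _≥_)
open import Data.Nat.Combinatorics using (_C_)

open import Data.Bool.Base using (Bool; true; false; not)
import Data.Bool.Properties as Bool
open import Data.Fin.Base as Fin
  using (Fin; zero; suc; inject₁; toℕ; fromℕ<; opposite; punchIn)
import Data.Fin.Permutation as Perm
open import Data.Fin.Permutation
  using (Permutation′; _⟨$⟩ʳ_; _⟨$⟩ˡ_; flip; insert; remove; reverse; _∘ₚ_)
import Data.Fin.Properties as Fin
open import Data.Integer.Base as ℤ using (1ℤ)
import Data.Integer.Properties as ℤ
open import Data.List.Base as List
  using (List; []; _∷_; _++_; allFin; filter; filterᵇ; length; map)
open import Data.List.Membership.Propositional using (_∈_)
open import Data.List.Membership.Propositional.Properties.WithK using (unique∧set⇒bag)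
open import Data.List.Membership.Setoid.Properties using (∈-map∘filter⁺; ∈-map∘filter⁻)
import Data.List.Properties as List
open import Data.List.Relation.Binary.BagAndSetEquality using (∼bag⇒↭)
open import Data.List.Relation.Binary.Permutation.Propositional as ↭ using (_↭_)
open import Data.List.Relation.Binary.Permutation.Propositional.Properties
  using () renaming (map⁺ to ↭-map⁺)
open import Data.List.Relation.Unary.All as All using (All)
import Data.List.Relation.Unary.All.Properties as All
open import Data.List.Relation.Unary.AllPairs using (AllPairs; []; _∷_)
import Data.List.Relation.Unary.AllPairs.Properties as AllPairs
open import Data.List.Relation.Unary.Unique.Propositional using (Unique)
open import Data.Nat.Base as ℕ using (zero; suc; z≤n; s≤s)
open import Data.Nat.Combinatorics using (nC1≡n; nCk+nC[k+1]≡[n+1]C[k+1])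
open import Data.Nat.ListAction using (sum)
import Data.Nat.Properties as ℕ
open import Algebra.Properties.CommutativeSemigroup ℕ.+-commutativeSemigroup
  using (x∙yz≈y∙xz)
open import Data.Product.Base using (_×_; _,_; proj₁; proj₂; ∃-syntax; swap)
open import Data.Sum.Base using (_⊎_; inj₁; inj₂)
open import Data.Vec.Base as Vec using (Vec; []; _∷_; lookup; tabulate)
import Data.Vec.Properties as Vec
open import Function.Base using (_∘_; id; const)
open import Function.Bundles using (_⇔_; mk⇔)
open import Function.Properties.Equivalence
  using () renaming (sym to ⇔-sym; trans to ⇔-trans)
open import Relation.Binary.Bundles using (Setoid)
open import Relation.Binary.Definitions using (_Respects_; tri<; tri≈; tri>)
open import Relation.Binary.PropositionalEquality as ≡
  using (_≡_; _≗_; refl; sym; trans; cong; cong₂; subst; subst₂; module ≡-Reasoning)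
open import Relation.Nullary.Decidable using (yes; no; does; dec-true; dec-false; does-⇔)
open import Relation.Nullary.Negation using (¬_; contradiction)
open import Relation.Unary using (Decidable)

private
  variable
    m n h : ℕ

-- Motzkin paths with level steps of two colours

-- A word is a vector of steps; its first and second row are the vectors of the
-- first and of the second bits.
Step : Set
Step = Bool × Bool

-- The word, read as a path starting at height h, stays at height ≥ 0 and ends
-- at height 0.
data Path : ℕ → Vec Step m → Set where
  done  : Path 0 []
  up    : {w : Vec Step m} → Path (suc h) w → Path h ((true , false) ∷ w)
  down  : {w : Vec Step m} → Path h w → Path (suc h) ((false , true) ∷ w)
  level : ∀ {b} {w : Vec Step m} → Path h w → Path h ((b , b) ∷ w)

-- Exchange of the two level colours.
dual : Step → Step
dual (b , c) = not c , not b

path-dual : {w : Vec Step m} → Path h w → Path h (Vec.map dual w)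
path-dual done      = done
path-dual (up p)    = up (path-dual p)
path-dual (down p)  = down (path-dual p)
path-dual (level p) = level (path-dual p)

-- The number of steps before the first one whose second bit is 1; it is the
-- length of the word if there is none.
lead : Vec Step m → Fin (suc m)
lead []                = zero
lead ((_ , true)  ∷ w) = zero
lead ((_ , false) ∷ w) = suc (lead w)

-- The first bit of the first step.
rises : Vec Step (suc m) → Bool
rises ((b , _) ∷ _) = b

-- In graft b k w the first row is that of w with b put in front.  The second
-- row consists of k zeros, a 1, and the second row of w without its first k
-- bits, cut off after suc m bits (so that there is no 1 if k is suc m).
graft : Bool → Fin (suc (suc m)) → Vec Step m → Vec Step (suc m)
graft b zero    w             = (b , true) ∷ w
graft b (suc k) []            = (b , false) ∷ []
graft b (suc k) ((c , _) ∷ w) = (b , false) ∷ graft c k w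

rises-graft : ∀ b k (w : Vec Step m) → rises (graft b k w) ≡ b
rises-graft b zero    w       = refl
rises-graft b (suc k) []      = refl
rises-graft b (suc k) (_ ∷ w) = refl

lead-graft : ∀ b k (w : Vec Step m) → lead (graft b k w) ≡ k
lead-graft b zero       w             = refl
lead-graft b (suc zero) []            = refl
lead-graft b (suc k)    ((c , _) ∷ w) = cong suc (lead-graft c k w)

-- If k is one more than the number of leading zeros, the inserted 1 falls on
-- the first 1 of the shifted second row, or past the end if there is none.
graft-lead : ∀ b (w : Vec Step m) → graft b (suc (lead w)) w ≡ (b , false) ∷ w
graft-lead b []                = refl
graft-lead b ((c , true)  ∷ w) = refl
graft-lead b ((c , false) ∷ w) = cong ((b , false) ∷_) (graft-lead c w)

-- The inverse of graft for k ≤ lead w: delete the first bit of the first row,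
-- and the first 1 of the second row (or, if there is none, one of its zeros).
prune : Vec Step (suc m) → Vec Step m
prune         ((_ , true)  ∷ w) = w
prune {zero}  ((_ , false) ∷ w) = []
prune {suc m} ((_ , false) ∷ w) = (rises w , false) ∷ prune w

graft-prune : (w : Vec Step (suc m)) → graft (rises w) (lead w) (prune w) ≡ w
graft-prune         ((b , true)  ∷ w)  = refl
graft-prune {zero}  ((b , false) ∷ []) = refl
graft-prune {suc m} ((b , false) ∷ w)  = cong ((b , false) ∷_) (graft-prune w)

prune-graft : ∀ b k (w : Vec Step m) → k Fin.≤ lead w → prune (graft b k w) ≡ w
prune-graft b zero    w                 k≤       = refl
prune-graft b (suc k) ((c , false) ∷ w) (s≤s k≤) =
  cong₂ (λ d u → (d , false) ∷ u) (rises-graft c k w) (prune-graft c k w k≤)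

-- The height from which the word graft b k w is a path, for k ≤ lead w and a
-- path w starting at height h.  A grafted first row shifts the first bits, so the
-- case b = 0 occurs in the recursion even where only b = 1 is of interest.
start : Bool → ℕ → ℕ
start true  h = h
start false h = suc h

-- Putting (b , 0) or (b , 1) in front of a path; by the choice of start, the
-- height after the step does not depend on b.
path-open : ∀ b {w : Vec Step m} → Path (suc h) w → Path (start b h) ((b , false) ∷ w)
path-open true  = up
path-open false = level

path-close : ∀ b {w : Vec Step m} → Path h w → Path (start b h) ((b , true) ∷ w)
path-close true  = level
path-close false = down

path-open⁻ : ∀ b {w : Vec Step m} → Path (start b h) ((b , false) ∷ w) → Path (suc h) w
path-open⁻ true  (up p)    = p
path-open⁻ false (level p) = p

path-close⁻ : ∀ b {w : Vec Step m} → Path (start b h) ((b , true) ∷ w) → Path h w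
path-close⁻ true  (level p) = p
path-close⁻ false (down p)  = p

path-graft : ∀ b k {w : Vec Step m} → k Fin.≤ lead w → Path h w → Path (start b h) (graft b k w)
path-graft b zero    k≤                           p         = path-close b p
path-graft b (suc k) {(_ , false) ∷ w} (s≤s k≤) (up p)    = path-open b (path-graft true k k≤ p)
path-graft b (suc k) {(_ , false) ∷ w} (s≤s k≤) (level p) = path-open b (path-graft false k k≤ p)

path-prune : (w : Vec Step (suc m)) → Path (start (rises w) h) w →
             Path h (prune w) × lead w Fin.≤ lead (prune w)
path-prune         ((b , true)  ∷ w) p = path-close⁻ b p , z≤n
path-prune {zero}  ((b , false) ∷ w) p with () ← path-open⁻ b p
path-prune {suc m} ((b , false) ∷ w@((true , _) ∷ _)) p
  with p′ , l ← path-prune w (path-open⁻ b p) = up p′ , s≤s l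
path-prune {suc m} ((b , false) ∷ w@((false , _) ∷ _)) p
  with p′ , l ← path-prune w (path-open⁻ b p) = level p′ , s≤s l

-- The two rows of graft b k w, bit by bit.
graft-fst-zero : ∀ b k (w : Vec Step m) → proj₁ (lookup (graft b k w) zero) ≡ b
graft-fst-zero b zero    w       = refl
graft-fst-zero b (suc k) []      = refl
graft-fst-zero b (suc k) (_ ∷ w) = refl

graft-fst-suc : ∀ b k (w : Vec Step m) i → proj₁ (lookup (graft b k w) (suc i)) ≡ proj₁ (lookup w i)
graft-fst-suc b zero    w             i       = refl
graft-fst-suc b (suc k) ((c , _) ∷ w) zero    = graft-fst-zero c k w
graft-fst-suc b (suc k) ((c , _) ∷ w) (suc i) = graft-fst-suc c k w i

graft-snd-< : ∀ b k (w : Vec Step m) i → i Fin.< k → proj₂ (lookup (graft b k w) i) ≡ false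
graft-snd-< b (suc k) []            zero    i<k       = refl
graft-snd-< b (suc k) (_ ∷ w)       zero    i<k       = refl
graft-snd-< b (suc k) ((c , _) ∷ w) (suc i) (s≤s i<k) = graft-snd-< c k w i i<k

graft-snd-≡ : ∀ b k (w : Vec Step m) i → toℕ i ≡ toℕ k → proj₂ (lookup (graft b k w) i) ≡ true
graft-snd-≡ b zero             w             zero    eq = refl
graft-snd-≡ b (suc (suc ()))   []            (suc i) eq
graft-snd-≡ b (suc k)          ((c , _) ∷ w) (suc i) eq = graft-snd-≡ c k w i (ℕ.suc-injective eq)

graft-snd-> : ∀ b k (w : Vec Step m) i → k Fin.≤ i →
              proj₂ (lookup (graft b k w) (suc i)) ≡ proj₂ (lookup w i)
graft-snd-> b zero    w             i       k≤i       = refl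
graft-snd-> b (suc k) ((c , _) ∷ w) (suc i) (s≤s k≤i) = graft-snd-> c k w i k≤i

-- Order reversal and punched-in values

opposite-+ : (i : Fin (suc n)) → toℕ (opposite i) ℕ.+ toℕ i ≡ n
opposite-+ {n}     zero    = trans (ℕ.+-identityʳ _) (Fin.toℕ-fromℕ n)
opposite-+ {suc n} (suc i) = begin
  toℕ (inject₁ (opposite i)) ℕ.+ suc (toℕ i) ≡⟨ cong (ℕ._+ suc (toℕ i)) (Fin.toℕ-inject₁ _) ⟩
  toℕ (opposite i) ℕ.+ suc (toℕ i)           ≡⟨ ℕ.+-suc _ _ ⟩
  suc (toℕ (opposite i) ℕ.+ toℕ i)           ≡⟨ cong suc (opposite-+ i) ⟩
  suc n                                      ∎
  where open ≡-Reasoning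

opposite-inject₁ : (i : Fin n) → opposite (inject₁ i) ≡ suc (opposite i)
opposite-inject₁ zero    = refl
opposite-inject₁ (suc i) = cong inject₁ (opposite-inject₁ i)

opposite-injective : {i j : Fin n} → opposite i ≡ opposite j → i ≡ j
opposite-injective {i = i} {j} eq =
  trans (sym (Fin.opposite-involutive i)) (trans (cong opposite eq) (Fin.opposite-involutive j))

opposite-anti-≤ : {i j : Fin n} → i Fin.≤ j → opposite j Fin.≤ opposite i
opposite-anti-≤ {suc n} {i} {j} i≤j = ℕ.+-cancelʳ-≤ (toℕ i) _ _ (begin
  toℕ (opposite j) ℕ.+ toℕ i ≤⟨ ℕ.+-monoʳ-≤ _ i≤j ⟩
  toℕ (opposite j) ℕ.+ toℕ j ≡⟨ opposite-+ j ⟩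
  n                          ≡⟨ opposite-+ i ⟨
  toℕ (opposite i) ℕ.+ toℕ i ∎)
  where open ℕ.≤-Reasoning

opposite-anti-< : {i j : Fin n} → i Fin.< j → opposite j Fin.< opposite i
opposite-anti-< i<j =
  Fin.≤∧≢⇒< (opposite-anti-≤ (ℕ.<⇒≤ i<j)) (λ eq → Fin.<⇒≢ i<j (sym (opposite-injective eq)))

opposite-cancel-< : {i j : Fin n} → opposite j Fin.< opposite i → i Fin.< j
opposite-cancel-< {i = i} {j} lt =
  subst₂ Fin._<_ (Fin.opposite-involutive i) (Fin.opposite-involutive j) (opposite-anti-< lt)

toℕ-punchIn-< : (j : Fin (suc n)) (v : Fin n) → v Fin.< j → toℕ (punchIn j v) ≡ toℕ v
toℕ-punchIn-< (suc j) zero    v<j       = refl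
toℕ-punchIn-< (suc j) (suc v) (s≤s v<j) = cong suc (toℕ-punchIn-< j v v<j)

toℕ-punchIn-≥ : (j : Fin (suc n)) (v : Fin n) → j Fin.≤ v → toℕ (punchIn j v) ≡ suc (toℕ v)
toℕ-punchIn-≥ zero    v       j≤v       = refl
toℕ-punchIn-≥ (suc j) (suc v) (s≤s j≤v) = cong suc (toℕ-punchIn-≥ j v j≤v)

punchIn-< : (j : Fin (suc n)) (v : Fin n) → punchIn j v Fin.< j → v Fin.< j
punchIn-< (suc j) zero    _        = s≤s z≤n
punchIn-< (suc j) (suc v) (s≤s lt) = s≤s (punchIn-< j v lt)

<-punchIn : (j : Fin (suc n)) (v : Fin n) → j Fin.< punchIn j v → j Fin.≤ v
<-punchIn zero    v       _        = z≤n
<-punchIn (suc j) (suc v) (s≤s lt) = s≤s (<-punchIn j v lt)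

punchIn-mono-< : (j : Fin (suc n)) {u v : Fin n} → u Fin.< v → punchIn j u Fin.< punchIn j v
punchIn-mono-< j {u} {v} u<v =
  ℕ.≰⇒> λ le → ℕ.<⇒≱ u<v (Fin.punchIn-cancel-≤ j v u le)

punchIn-cancel-< : (j : Fin (suc n)) {u v : Fin n} → punchIn j u Fin.< punchIn j v → u Fin.< v
punchIn-cancel-< j {u} {v} lt =
  ℕ.≰⇒> λ le → ℕ.<⇒≱ lt (Fin.punchIn-mono-≤ j v u le)

-- Congruence with respect to pointwise equality of permutations

injective : (σ : Permutation′ n) {x y : Fin n} → σ ⟨$⟩ʳ x ≡ σ ⟨$⟩ʳ y → x ≡ y
injective σ eq =
  trans (sym (Perm.inverseˡ σ)) (trans (cong (σ ⟨$⟩ˡ_) eq) (Perm.inverseˡ σ))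

flip-cong : (σ τ : Permutation′ n) → σ Perm.≈ τ → flip σ Perm.≈ flip τ
flip-cong σ τ σ≈τ i =
  injective τ (trans (sym (σ≈τ _)) (trans (Perm.inverseʳ σ) (sym (Perm.inverseʳ τ))))

contains132-cong : (σ τ : Permutation′ n) → σ Perm.≈ τ → Contains132 σ → Contains132 τ
contains132-cong σ τ eq (i , j , k , i<j , j<k , p , r) =
  i , j , k , i<j , j<k , subst₂ Fin._<_ (eq i) (eq k) p , subst₂ Fin._<_ (eq k) (eq j) r

contains213-cong : (σ τ : Permutation′ n) → σ Perm.≈ τ → Contains213 σ → Contains213 τ
contains213-cong σ τ eq (i , j , k , i<j , j<k , p , r) =
  i , j , k , i<j , j<k , subst₂ Fin._<_ (eq j) (eq i) p , subst₂ Fin._<_ (eq i) (eq k) r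

-- Words of permutations

-- Whether position i + 1, counted from 1, is a descent.
descent : Permutation′ (suc m) → Fin m → Bool
descent σ i = does ((σ ⟨$⟩ʳ suc i) Fin.<? (σ ⟨$⟩ʳ inject₁ i))

descent-cong : (σ τ : Permutation′ (suc m)) → σ Perm.≈ τ → descent σ ≗ descent τ
descent-cong σ τ eq i = cong₂ (λ x y → does (x Fin.<? y)) (eq (suc i)) (eq (inject₁ i))

-- For σ in S_(m+1) and i counted from 0, the second bit tells whether m - i is
-- a descent of σ⁻¹, since opposite i is m - 1 - i.
step : Permutation′ (suc m) → Fin m → Step
step σ i = descent σ i , descent (flip σ) (opposite i)

word : Permutation′ (suc m) → Vec Step m
word σ = tabulate (step σ)

word-cong : (σ τ : Permutation′ (suc m)) → σ Perm.≈ τ → word σ ≡ word τ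
word-cong σ τ eq = Vec.tabulate-cong λ i →
  cong₂ _,_ (descent-cong σ τ eq i)
            (descent-cong (flip σ) (flip τ) (flip-cong σ τ eq) (opposite i))

descent-flip : (σ : Permutation′ (suc m)) (v : Fin m) {x y : Fin (suc m)} →
               σ ⟨$⟩ʳ x ≡ suc v → σ ⟨$⟩ʳ y ≡ inject₁ v → descent (flip σ) v ≡ does (x Fin.<? y)
descent-flip σ v x↦ y↦ = cong₂ (λ x y → does (x Fin.<? y))
  (trans (cong (σ ⟨$⟩ˡ_) (sym x↦)) (Perm.inverseˡ σ))
  (trans (cong (σ ⟨$⟩ˡ_) (sym y↦)) (Perm.inverseˡ σ))

-- Removing the first entry of a 132-avoiding permutation

-- σ has first entry j, and its other entries are ordered as π.  It holds for
-- π = remove zero σ as well as for σ = insert zero j π.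
record Extends (σ : Permutation′ (suc n)) (j : Fin (suc n)) (π : Permutation′ n) : Set where
  field
    at-zero : σ ⟨$⟩ʳ zero ≡ j
    at-suc  : ∀ x → σ ⟨$⟩ʳ suc x ≡ punchIn j (π ⟨$⟩ʳ x)

open Extends

insert-extends : ∀ j (π : Permutation′ n) → Extends (insert zero j π) j π
insert-extends j π = record { at-zero = refl ; at-suc = Perm.insert-punchIn zero j π }

remove-extends : (σ : Permutation′ (suc n)) → Extends σ (σ ⟨$⟩ʳ zero) (remove zero σ)
remove-extends σ = record { at-zero = refl ; at-suc = Perm.punchIn-permute σ zero }

module _ {σ : Permutation′ (suc n)} {j : Fin (suc n)} {π : Permutation′ n}
         (ext : Extends σ j π) where

  <-lift : ∀ {x y} → (π ⟨$⟩ʳ x) Fin.< (π ⟨$⟩ʳ y) → (σ ⟨$⟩ʳ suc x) Fin.< (σ ⟨$⟩ʳ suc y)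
  <-lift {x} {y} lt =
    subst₂ Fin._<_ (sym (at-suc ext x)) (sym (at-suc ext y)) (punchIn-mono-< j lt)

  <-lower : ∀ {x y} → (σ ⟨$⟩ʳ suc x) Fin.< (σ ⟨$⟩ʳ suc y) → (π ⟨$⟩ʳ x) Fin.< (π ⟨$⟩ʳ y)
  <-lower {x} {y} lt =
    punchIn-cancel-< j (subst₂ Fin._<_ (at-suc ext x) (at-suc ext y) lt)

  contains132-lift : Contains132 π → Contains132 σ
  contains132-lift (x , y , z , x<y , y<z , p , r) =
    suc x , suc y , suc z , s≤s x<y , s≤s y<z , <-lift p , <-lift r

module _ {σ : Permutation′ (suc (suc m))} {j : Fin (suc (suc m))} {π : Permutation′ (suc m)}
         (ext : Extends σ j π) where

  private
    π₀ : Fin (suc m)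
    π₀ = π ⟨$⟩ʳ zero

  -- If j < π₀, the first two entries of σ are j and some entry greater than
  -- j + 1; with the entry j + 1 further right they form a 132.
  avoids132-first : ¬ Contains132 σ → π₀ Fin.≤ j
  avoids132-first avoids = ℕ.≮⇒≥ λ j<π₀ → avoids (occurrence j<π₀)
    where
    occurrence : j Fin.< π₀ → Contains132 σ
    occurrence j<π₀ = zero , suc zero , suc y , s≤s z≤n , s≤s (0<y y π-y)
                    , subst₂ ℕ._<_ (cong toℕ (sym (at-zero ext))) (sym toℕ-σ-y) ℕ.≤-refl
                    , <-lift ext (subst (Fin._< π₀) (sym π-y) j′<π₀)
      where
      j<1+m : toℕ j ℕ.< suc m
      j<1+m = ℕ.<-trans j<π₀ (Fin.toℕ<n π₀)
      j′ : Fin (suc m)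
      j′ = fromℕ< j<1+m
      toℕ-j′ : toℕ j′ ≡ toℕ j
      toℕ-j′ = Fin.toℕ-fromℕ< j<1+m
      j′<π₀ : j′ Fin.< π₀
      j′<π₀ = subst (ℕ._< toℕ π₀) (sym toℕ-j′) j<π₀
      y : Fin (suc m)
      y = π ⟨$⟩ˡ j′
      π-y : π ⟨$⟩ʳ y ≡ j′
      π-y = Perm.inverseʳ π
      0<y : ∀ y → π ⟨$⟩ʳ y ≡ j′ → zero {m} Fin.< y
      0<y zero    eq = contradiction (sym eq) (Fin.<⇒≢ j′<π₀)
      0<y (suc y) eq = s≤s z≤n
      toℕ-σ-y : toℕ (σ ⟨$⟩ʳ suc y) ≡ suc (toℕ j)
      toℕ-σ-y = trans (cong toℕ (trans (at-suc ext y) (cong (punchIn j) π-y)))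
               (trans (toℕ-punchIn-≥ j j′ (ℕ.≤-reflexive (sym toℕ-j′))) (cong suc toℕ-j′))

  -- A 132 of σ starting with j comes from entries v > u ≥ j of π, with v to the
  -- left of u.  As v > j ≥ π₀, neither of them is π₀ itself, so that π₀, v, u is
  -- a 132 of π.
  avoids132-extend : ¬ Contains132 π → π₀ Fin.≤ j → ¬ Contains132 σ
  avoids132-extend avoids π₀≤j (zero , suc zero , suc z , _ , _ , p , r) =
    ℕ.<⇒≱ (<-lower ext r) (ℕ.≤-trans π₀≤j
      (<-punchIn j _ (subst₂ Fin._<_ (at-zero ext) (at-suc ext z) p)))
  avoids132-extend avoids π₀≤j (zero , suc (suc y) , suc z@(suc _) , _ , s≤s y<z , p , r) =
    avoids (zero , suc y , z , s≤s z≤n , y<z , Fin.≤∧≢⇒< π₀≤πz (λ eq → Fin.0≢1+n (injective π eq))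
           , <-lower ext r)
    where
    π₀≤πz : π₀ Fin.≤ (π ⟨$⟩ʳ z)
    π₀≤πz = ℕ.≤-trans π₀≤j (<-punchIn j _ (subst₂ Fin._<_ (at-zero ext) (at-suc ext z) p))
  avoids132-extend avoids π₀≤j (suc x , suc y , suc z , s≤s x<y , s≤s y<z , p , r) =
    avoids (x , y , z , x<y , y<z , <-lower ext p , <-lower ext r)

  descent-zero : descent σ zero ≡ does (π₀ Fin.<? j)
  descent-zero = does-⇔ (mk⇔ to from) (_ Fin.<? _) (π₀ Fin.<? j)
    where
    to : (σ ⟨$⟩ʳ suc zero) Fin.< (σ ⟨$⟩ʳ zero) → π₀ Fin.< j
    to lt = punchIn-< j _ (subst₂ Fin._<_ (at-suc ext zero) (at-zero ext) lt)
    from : π₀ Fin.< j → (σ ⟨$⟩ʳ suc zero) Fin.< (σ ⟨$⟩ʳ zero)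
    from lt = subst₂ Fin._<_ (sym (at-suc ext zero)) (sym (at-zero ext))
      (subst (ℕ._< toℕ j) (sym (toℕ-punchIn-< j _ lt)) lt)

  descent-suc : ∀ i → descent σ (suc i) ≡ descent π i
  descent-suc i = does-⇔ (mk⇔ (<-lower ext) (<-lift ext)) (_ Fin.<? _) (_ Fin.<? _)

  -- Descents of σ⁻¹ at values below j - 1 are those of π⁻¹.
  inverse-descent-< : (v : Fin m) → suc v Fin.< j →
                      descent (flip σ) (inject₁ v) ≡ descent (flip π) v
  inverse-descent-< v 1+v<j =
    descent-flip σ (inject₁ v)
      (value (suc v) 1+v<j)
      (value (inject₁ v) (subst (ℕ._< toℕ j) (sym (Fin.toℕ-inject₁ v)) (ℕ.<⇒≤ 1+v<j)))
    where
    value : (u : Fin (suc m)) → u Fin.< j → σ ⟨$⟩ʳ suc (π ⟨$⟩ˡ u) ≡ inject₁ u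
    value u u<j = trans (at-suc ext _) (trans (cong (punchIn j) (Perm.inverseʳ π))
      (Fin.toℕ-injective (trans (toℕ-punchIn-< j u u<j) (sym (Fin.toℕ-inject₁ u)))))

  -- The value j stands in front of all others, hence in front of j - 1.
  inverse-descent-≡ : (v : Fin (suc m)) → j ≡ suc v → descent (flip σ) v ≡ true
  inverse-descent-≡ v j≡1+v =
    trans (descent-flip σ v (trans (at-zero ext) j≡1+v) (Perm.inverseʳ σ))
          (dec-true (zero {suc m} Fin.<? (σ ⟨$⟩ˡ inject₁ v)) (0<y _ (Perm.inverseʳ σ)))
    where
    0<y : ∀ y → σ ⟨$⟩ʳ y ≡ inject₁ v → zero {suc m} Fin.< y
    0<y zero    eq = contradiction (cong toℕ (trans (sym j≡1+v) (trans (sym (at-zero ext)) eq)))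
      (λ eq′ → ℕ.1+n≢n (trans eq′ (Fin.toℕ-inject₁ v)))
    0<y (suc y) eq = s≤s z≤n

  -- The entries of σ larger than j appear in increasing order.
  inverse-descent-> : ¬ Contains132 σ → (v : Fin (suc m)) → j Fin.≤ v → descent (flip σ) v ≡ false
  inverse-descent-> avoids v j≤v =
    dec-false (x Fin.<? y) λ x<y → avoids
      (zero , x , y , 0<x x (Perm.inverseʳ σ) , x<y
      , Fin.≤∧≢⇒< σ₀≤σy (λ eq → Fin.<⇒≢ (ℕ.≤-<-trans z≤n x<y) (injective σ eq))
      , subst₂ Fin._<_ (sym (Perm.inverseʳ σ)) (sym (Perm.inverseʳ σ))
          (s≤s (ℕ.≤-reflexive (Fin.toℕ-inject₁ v))))
    where
    x y : Fin (suc (suc m))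
    x = σ ⟨$⟩ˡ suc v
    y = σ ⟨$⟩ˡ inject₁ v
    0<x : ∀ x → σ ⟨$⟩ʳ x ≡ suc v → zero {suc m} Fin.< x
    0<x zero    eq = contradiction j≤v
      (ℕ.<⇒≱ (ℕ.≤-reflexive (cong toℕ (trans (sym eq) (at-zero ext)))))
    0<x (suc x) eq = s≤s z≤n
    σ₀≤σy : (σ ⟨$⟩ʳ zero) Fin.≤ (σ ⟨$⟩ʳ y)
    σ₀≤σy = subst₂ Fin._≤_ (sym (at-zero ext)) (sym (Perm.inverseʳ σ))
      (subst (toℕ j ℕ.≤_) (sym (Fin.toℕ-inject₁ v)) j≤v)

  word-extends : ¬ Contains132 σ →
                 word σ ≡ graft (does (π₀ Fin.<? j)) (opposite j) (word π)
  word-extends avoids = trans (Vec.tabulate-cong pointwise) (Vec.tabulate∘lookup _)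
    where
    b : Bool
    b = does (π₀ Fin.<? j)

    first : ∀ i → descent σ i ≡ proj₁ (lookup (graft b (opposite j) (word π)) i)
    first zero    = trans descent-zero (sym (graft-fst-zero b (opposite j) (word π)))
    first (suc i) = begin
      descent σ (suc i)
        ≡⟨ descent-suc i ⟩
      descent π i
        ≡⟨ cong proj₁ (Vec.lookup∘tabulate (step π) i) ⟨
      proj₁ (lookup (word π) i)
        ≡⟨ graft-fst-suc b (opposite j) (word π) i ⟨
      proj₁ (lookup (graft b (opposite j) (word π)) (suc i)) ∎
      where open ≡-Reasoning

    -- The number of leading zeros, opposite j, compares with i as
    -- opposite i + 1 compares with j.
    balance : (i : Fin (suc m)) →
              toℕ (opposite j) ℕ.+ toℕ j ≡ toℕ i ℕ.+ suc (toℕ (opposite i))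
    balance i = begin
      toℕ (opposite j) ℕ.+ toℕ j           ≡⟨ opposite-+ j ⟩
      suc m                                ≡⟨ cong suc (opposite-+ i) ⟨
      suc (toℕ (opposite i) ℕ.+ toℕ i)     ≡⟨ ℕ.+-comm (suc (toℕ (opposite i))) (toℕ i) ⟩
      toℕ i ℕ.+ suc (toℕ (opposite i))     ∎
      where open ≡-Reasoning

    second : ∀ i → descent (flip σ) (opposite i) ≡ proj₂ (lookup (graft b (opposite j) (word π)) i)
    second i with ℕ.<-cmp (toℕ j) (suc (toℕ (opposite i)))
    ... | tri< j≤v _ _ = trans (inverse-descent-> avoids (opposite i) (ℕ.s≤s⁻¹ j≤v))
      (sym (graft-snd-< b (opposite j) (word π) i
        (ℕ.≰⇒> λ k≤i → ℕ.<⇒≢ (ℕ.+-mono-≤-< k≤i j≤v) (balance i))))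
    ... | tri≈ _ j≡1+v _ = trans (inverse-descent-≡ (opposite i) (Fin.toℕ-injective j≡1+v))
      (sym (graft-snd-≡ b (opposite j) (word π) i
        (sym (ℕ.+-cancelʳ-≡ (toℕ j) _ _ (trans (balance i) (cong (toℕ i ℕ.+_) (sym j≡1+v)))))))
    second zero | tri> _ _ 1+v<j =
      contradiction (sym (balance zero))
        (ℕ.<⇒≢ (ℕ.<-≤-trans 1+v<j (ℕ.m≤n+m _ (toℕ (opposite j)))))
    second (suc i) | tri> _ _ 1+v<j = begin
      descent (flip σ) (inject₁ (opposite i))
        ≡⟨ inverse-descent-< (opposite i)
             (subst (ℕ._< toℕ j) (cong suc (Fin.toℕ-inject₁ (opposite i))) 1+v<j) ⟩
      descent (flip π) (opposite i)
        ≡⟨ cong proj₂ (Vec.lookup∘tabulate (step π) i) ⟨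
      proj₂ (lookup (word π) i)
        ≡⟨ graft-snd-> b (opposite j) (word π) i
             (ℕ.≮⇒≥ λ i<k → ℕ.<⇒≢ (ℕ.+-mono-≤-< i<k 1+v<j) (sym (balance (suc i)))) ⟨
      proj₂ (lookup (graft b (opposite j) (word π)) (suc i)) ∎
      where open ≡-Reasoning

    pointwise : step σ ≗ lookup (graft b (opposite j) (word π))
    pointwise i = cong₂ _,_ (first i) (second i)

-- The word of a 132-avoiding permutation determines it

lead-word : (σ : Permutation′ (suc m)) → ¬ Contains132 σ → lead (word σ) ≡ opposite (σ ⟨$⟩ʳ zero)
lead-word {zero}  σ avoids with zero ← σ ⟨$⟩ʳ zero = refl
lead-word {suc m} σ avoids =
  trans (cong lead (word-extends (remove-extends σ) avoids))
        (lead-graft _ (opposite (σ ⟨$⟩ʳ zero)) _)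

<⇒opposite-≤ : {i : Fin n} {j : Fin (suc n)} → i Fin.< j → opposite j Fin.≤ opposite i
<⇒opposite-≤ {i = i} {j} i<j = ℕ.s≤s⁻¹ (subst (opposite j Fin.<_) (opposite-inject₁ i)
  (opposite-anti-< (subst (ℕ._< toℕ j) (sym (Fin.toℕ-inject₁ i)) i<j)))

opposite-≤⇒< : {i : Fin n} {j : Fin (suc n)} → opposite j Fin.≤ opposite i → i Fin.< j
opposite-≤⇒< {i = i} {j} le = subst (ℕ._< toℕ j) (Fin.toℕ-inject₁ i)
  (opposite-cancel-< (subst (opposite j Fin.<_) (sym (opposite-inject₁ i)) (s≤s le)))

module _ {σ : Permutation′ (suc (suc m))} {j : Fin (suc (suc m))} {π : Permutation′ (suc m)}
         (ext : Extends σ j π) (avoids : ¬ Contains132 σ) where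

  avoids132-lower : ¬ Contains132 π
  avoids132-lower = avoids ∘ contains132-lift ext

  word-graft : (π ⟨$⟩ʳ zero) Fin.< j → word σ ≡ graft true (opposite j) (word π)
  word-graft π₀<j = trans (word-extends ext avoids)
    (cong (λ b → graft b (opposite j) (word π)) (dec-true ((π ⟨$⟩ʳ zero) Fin.<? j) π₀<j))

  word-level : toℕ (π ⟨$⟩ʳ zero) ≡ toℕ j → word σ ≡ (false , false) ∷ word π
  word-level π₀≡j = begin
    word σ
      ≡⟨ word-extends ext avoids ⟩
    graft (does ((π ⟨$⟩ʳ zero) Fin.<? j)) (opposite j) (word π)
      ≡⟨ cong₂ (λ b k → graft b k (word π))
           (dec-false ((π ⟨$⟩ʳ zero) Fin.<? j) (ℕ.<-irrefl π₀≡j)) opposite-j ⟩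
    graft false (suc (lead (word π))) (word π)
      ≡⟨ graft-lead false (word π) ⟩
    (false , false) ∷ word π ∎
    where
    open ≡-Reasoning
    opposite-j : opposite j ≡ suc (lead (word π))
    opposite-j = begin
      opposite j
        ≡⟨ cong opposite (Fin.toℕ-injective (trans (Fin.toℕ-inject₁ _) π₀≡j)) ⟨
      opposite (inject₁ (π ⟨$⟩ʳ zero))
        ≡⟨ opposite-inject₁ (π ⟨$⟩ʳ zero) ⟩
      suc (opposite (π ⟨$⟩ʳ zero))
        ≡⟨ cong suc (lead-word π avoids132-lower) ⟨
      suc (lead (word π)) ∎

  word-cases : word σ ≡ (false , false) ∷ word π
             ⊎ opposite j Fin.≤ lead (word π) × word σ ≡ graft true (opposite j) (word π)
  word-cases with ℕ.m≤n⇒m<n∨m≡n (avoids132-first ext avoids)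
  ... | inj₁ π₀<j = inj₂
    ( subst (opposite j Fin.≤_) (sym (lead-word π avoids132-lower)) (<⇒opposite-≤ π₀<j)
    , word-graft π₀<j)
  ... | inj₂ π₀≡j = inj₁ (word-level π₀≡j)

word-path : (σ : Permutation′ (suc m)) → ¬ Contains132 σ → Path 0 (word σ)
word-path {zero}  σ avoids = done
word-path {suc m} σ avoids
  with ext ← remove-extends σ
  with ih ← word-path (remove zero σ) (avoids132-lower ext avoids) | word-cases ext avoids
... | inj₁ eq        = subst (Path 0) (sym eq) (level ih)
... | inj₂ (k≤ , eq) = subst (Path 0) (sym eq) (path-graft true _ k≤ ih)

word-surjective : {w : Vec Step m} → Path 0 w → ∃[ σ ] ¬ Contains132 σ × word σ ≡ w
word-surjective done = Perm.id , (λ { (zero , zero , _ , () , _) }) , refl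
word-surjective {w = (false , false) ∷ w} (level p) with π , avoids-π , refl ← word-surjective p =
  insert zero j π , avoids , word-level ext avoids (sym (Fin.toℕ-inject₁ _))
  where
  j = inject₁ (π ⟨$⟩ʳ zero)
  ext = insert-extends j π
  avoids = avoids132-extend ext avoids-π (ℕ.≤-reflexive (sym (Fin.toℕ-inject₁ _)))
word-surjective {m = suc m} {w = w@((true , _) ∷ _)} p
  with p′ , k≤ ← path-prune w p
  with π , avoids-π , π≡ ← word-surjective p′ =
  insert zero j π , avoids , eq
  where
  j = opposite (lead w)
  ext = insert-extends j π
  π₀<j : (π ⟨$⟩ʳ zero) Fin.< j
  π₀<j = opposite-≤⇒< (subst₂ Fin._≤_ (sym (Fin.opposite-involutive (lead w)))
    (trans (cong lead (sym π≡)) (lead-word π avoids-π)) k≤)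
  avoids = avoids132-extend ext avoids-π (ℕ.<⇒≤ π₀<j)
  eq : word (insert zero j π) ≡ w
  eq = begin
    word (insert zero j π)
      ≡⟨ word-graft ext avoids π₀<j ⟩
    graft true (opposite j) (word π)
      ≡⟨ cong₂ (graft true) (Fin.opposite-involutive (lead w)) π≡ ⟩
    graft true (lead w) (prune w)
      ≡⟨ graft-prune w ⟩
    w ∎
    where open ≡-Reasoning

-- Recovers, for 132-avoiding σ, the word of σ without its first entry from the
-- word of σ.  The second case is a filler: a path starting at height 0 never
-- has the first step (0 , 1).
strip : Vec Step (suc m) → Vec Step m
strip ((false , false) ∷ w) = w
strip ((false , true)  ∷ w) = w
strip ((true  , c)     ∷ w) = prune ((true , c) ∷ w)

strip-word : (σ : Permutation′ (suc (suc m))) → ¬ Contains132 σ →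
             strip (word σ) ≡ word (remove zero σ)
strip-word σ avoids with word-cases (remove-extends σ) avoids
... | inj₁ eq        = cong strip eq
... | inj₂ (k≤ , eq) = begin
  strip (word σ)             ≡⟨ cong strip eq ⟩
  strip (graft true k w)     ≡⟨ strip-rises (graft true k w) (rises-graft true k w) ⟩
  prune (graft true k w)     ≡⟨ prune-graft true k w k≤ ⟩
  w                          ∎
  where
  open ≡-Reasoning
  k = opposite (σ ⟨$⟩ʳ zero)
  w = word (remove zero σ)
  strip-rises : (u : Vec Step (suc n)) → rises u ≡ true → strip u ≡ prune u
  strip-rises ((true , _) ∷ u) refl = refl

word-injective : (σ τ : Permutation′ (suc m)) → ¬ Contains132 σ → ¬ Contains132 τ →
                 word σ ≡ word τ → σ Perm.≈ τ
word-injective {zero}  σ τ avoids-σ avoids-τ eq x with zero ← σ ⟨$⟩ʳ x | zero ← τ ⟨$⟩ʳ x = refl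
word-injective {suc m} σ τ avoids-σ avoids-τ eq = pointwise
  where
  first : σ ⟨$⟩ʳ zero ≡ τ ⟨$⟩ʳ zero
  first = opposite-injective
    (trans (sym (lead-word σ avoids-σ)) (trans (cong lead eq) (lead-word τ avoids-τ)))
  rest : remove zero σ Perm.≈ remove zero τ
  rest = word-injective (remove zero σ) (remove zero τ)
    (avoids132-lower (remove-extends σ) avoids-σ) (avoids132-lower (remove-extends τ) avoids-τ)
    (trans (sym (strip-word σ avoids-σ)) (trans (cong strip eq) (strip-word τ avoids-τ)))
  pointwise : σ Perm.≈ τ
  pointwise zero    = first
  pointwise (suc x) = begin
    σ ⟨$⟩ʳ suc x                                     ≡⟨ at-suc (remove-extends σ) x ⟩
    punchIn (σ ⟨$⟩ʳ zero) (remove zero σ ⟨$⟩ʳ x)     ≡⟨ cong₂ punchIn first (rest x) ⟩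
    punchIn (τ ⟨$⟩ʳ zero) (remove zero τ ⟨$⟩ʳ x)     ≡⟨ at-suc (remove-extends τ) x ⟨
    τ ⟨$⟩ʳ suc x                                     ∎
    where open ≡-Reasoning

-- Reflection in the anti-diagonal

-- The reverse-complement of the inverse, x ↦ n + 1 - σ⁻¹(n + 1 - x).
antitranspose : Permutation′ n → Permutation′ n
antitranspose σ = reverse ∘ₚ flip σ ∘ₚ reverse

antitranspose-involutive : (σ : Permutation′ n) → antitranspose (antitranspose σ) Perm.≈ σ
antitranspose-involutive σ x =
  trans (Fin.opposite-involutive _) (cong (σ ⟨$⟩ʳ_) (Fin.opposite-involutive x))

antitranspose-cong : (σ τ : Permutation′ n) → σ Perm.≈ τ → antitranspose σ Perm.≈ antitranspose τ
antitranspose-cong σ τ eq x = cong opposite (flip-cong σ τ eq (opposite x))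

module _ (σ : Permutation′ n) where

  private
    -- The point (x , σ x) of the diagram of σ goes to the point with
    -- coordinates opposite (σ x) and opposite x.
    at-image : ∀ x → antitranspose σ ⟨$⟩ʳ opposite (σ ⟨$⟩ʳ x) ≡ opposite x
    at-image x = cong opposite
      (trans (cong (σ ⟨$⟩ˡ_) (Fin.opposite-involutive _)) (Perm.inverseˡ σ))

    antitranspose-< : ∀ {x y} → x Fin.< y →
      (antitranspose σ ⟨$⟩ʳ opposite (σ ⟨$⟩ʳ y)) Fin.< (antitranspose σ ⟨$⟩ʳ opposite (σ ⟨$⟩ʳ x))
    antitranspose-< {x} {y} lt =
      subst₂ Fin._<_ (sym (at-image y)) (sym (at-image x)) (opposite-anti-< lt)

  contains213⇒132 : Contains213 σ → Contains132 (antitranspose σ)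
  contains213⇒132 (i , j , k , i<j , j<k , p , r) =
    opposite (σ ⟨$⟩ʳ k) , opposite (σ ⟨$⟩ʳ i) , opposite (σ ⟨$⟩ʳ j) ,
    opposite-anti-< r , opposite-anti-< p , antitranspose-< j<k , antitranspose-< i<j

  contains132⇒213 : Contains132 σ → Contains213 (antitranspose σ)
  contains132⇒213 (i , j , k , i<j , j<k , p , r) =
    opposite (σ ⟨$⟩ʳ j) , opposite (σ ⟨$⟩ʳ k) , opposite (σ ⟨$⟩ʳ i) ,
    opposite-anti-< r , opposite-anti-< p , antitranspose-< j<k , antitranspose-< i<j

descent-antitranspose : (σ : Permutation′ (suc m)) (i : Fin m) →
                        descent (antitranspose σ) i ≡ descent (flip σ) (opposite i)
descent-antitranspose σ i = does-⇔ (mk⇔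
    (λ lt → subst below (opposite-inject₁ i) (opposite-cancel-< lt))
    (λ lt → opposite-anti-< (subst below (sym (opposite-inject₁ i)) lt)))
  (_ Fin.<? _) (_ Fin.<? _)
  where
  below : Fin _ → Set
  below x = (σ ⟨$⟩ˡ x) Fin.< (σ ⟨$⟩ˡ inject₁ (opposite i))

word-antitranspose : (σ : Permutation′ (suc m)) → word (antitranspose σ) ≡ Vec.map swap (word σ)
word-antitranspose σ = trans (Vec.tabulate-cong pointwise) (Vec.tabulate-∘ swap (step σ))
  where
  pointwise : step (antitranspose σ) ≗ swap ∘ step σ
  pointwise i = cong₂ _,_ (descent-antitranspose σ i) (begin
    descent (flip (antitranspose σ)) (opposite i) ≡⟨ descent-antitranspose (flip σ) (opposite i) ⟩
    descent σ (opposite (opposite i))             ≡⟨ cong (descent σ) (Fin.opposite-involutive i) ⟩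
    descent σ i                                   ∎)
    where open ≡-Reasoning

-- The statistics as functions of the word

filter≡filterᵇ : {A : Set} {P : A → Set} (P? : Decidable P) (xs : List A) →
                 filter P? xs ≡ filterᵇ (does ∘ P?) xs
filter≡filterᵇ P? []       = refl
filter≡filterᵇ P? (x ∷ xs) with does (P? x)
... | true  = cong (x ∷_) (filter≡filterᵇ P? xs)
... | false = filter≡filterᵇ P? xs

filterᵇ-cong : {A : Set} {f g : A → Bool} → f ≗ g → filterᵇ f ≗ filterᵇ g
filterᵇ-cong             f≗g []       = refl
filterᵇ-cong {f = f} {g} f≗g (x ∷ xs) with f x | g x | f≗g x
... | true  | _ | refl = cong (x ∷_) (filterᵇ-cong f≗g xs)
... | false | _ | refl = filterᵇ-cong f≗g xs

sum-filter-not : {A : Set} (g : A → ℕ) (f : A → Bool) (xs : List A) →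
  sum (map g (filterᵇ f xs)) ℕ.+ sum (map g (filterᵇ (not ∘ f) xs)) ≡ sum (map g xs)
sum-filter-not g f []       = refl
sum-filter-not g f (x ∷ xs) with f x
... | true  = trans (ℕ.+-assoc (g x) _ _) (cong (g x ℕ.+_) (sum-filter-not g f xs))
... | false = begin
  u ℕ.+ (g x ℕ.+ v) ≡⟨ x∙yz≈y∙xz u (g x) v ⟩
  g x ℕ.+ (u ℕ.+ v) ≡⟨ cong (g x ℕ.+_) (sum-filter-not g f xs) ⟩
  g x ℕ.+ sum (map g xs) ∎
  where
  open ≡-Reasoning
  u = sum (map g (filterᵇ f xs))
  v = sum (map g (filterᵇ (not ∘ f) xs))

length≡sum : {A : Set} (xs : List A) → length xs ≡ sum (map (const 1) xs)
length≡sum []       = refl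
length≡sum (x ∷ xs) = cong suc (length≡sum xs)

-- The sum of the weights g i over the i with f i = 1.
total : (Fin m → ℕ) → (Fin m → Bool) → ℕ
total {m} g f = sum (map g (filterᵇ f (allFin m)))

total-cong : (g : Fin m → ℕ) {f f′ : Fin m → Bool} → f ≗ f′ → total g f ≡ total g f′
total-cong g f≗f′ = cong (sum ∘ map g) (filterᵇ-cong f≗f′ (allFin _))

total-not : (g : Fin m → ℕ) (f : Fin m → Bool) →
            total g (not ∘ f) ≡ sum (map g (allFin m)) ∸ total g f
total-not {m} g f = begin
  total g (not ∘ f)
    ≡⟨ ℕ.m+n∸m≡n (total g f) _ ⟨
  total g f ℕ.+ total g (not ∘ f) ∸ total g f
    ≡⟨ cong (_∸ total g f) (sum-filter-not g f (allFin m)) ⟩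
  sum (map g (allFin m)) ∸ total g f ∎
  where open ≡-Reasoning

sum-const-1 : ∀ m → sum (map (const 1) (allFin m)) ≡ m
sum-const-1 m = trans (sym (length≡sum (allFin m))) (List.length-tabulate id)

sum-positions : ∀ m → sum (map (suc ∘ toℕ) (allFin m)) ≡ suc m C 2
sum-positions m = trans (cong sum (List.map-tabulate id (suc ∘ toℕ {m}))) (triangle m)
  where
  open ≡-Reasoning
  sum-suc : ∀ m (g : Fin m → ℕ) →
            sum (List.tabulate (suc ∘ g)) ≡ m ℕ.+ sum (List.tabulate g)
  sum-suc zero    g = refl
  sum-suc (suc m) g = cong suc (begin
    g zero ℕ.+ sum (List.tabulate (suc ∘ g ∘ suc))
      ≡⟨ cong (g zero ℕ.+_) (sum-suc m (g ∘ suc)) ⟩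
    g zero ℕ.+ (m ℕ.+ sum (List.tabulate (g ∘ suc)))
      ≡⟨ x∙yz≈y∙xz (g zero) m _ ⟩
    m ℕ.+ (g zero ℕ.+ sum (List.tabulate (g ∘ suc))) ∎)
  triangle : ∀ m → sum (List.tabulate (suc ∘ toℕ {m})) ≡ suc m C 2
  triangle zero    = refl
  triangle (suc m) = begin
    suc (sum (List.tabulate (λ i → suc (suc (toℕ {m} i)))))
      ≡⟨ cong suc (sum-suc m (λ i → suc (toℕ i))) ⟩
    suc m ℕ.+ sum (List.tabulate (suc ∘ toℕ {m}))
      ≡⟨ cong₂ ℕ._+_ (sym (nC1≡n (suc m))) (triangle m) ⟩
    (suc m C 1) ℕ.+ (suc m C 2)
      ≡⟨ nCk+nC[k+1]≡[n+1]C[k+1] (suc m) 1 ⟩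
    suc (suc m) C 2 ∎

-- The exponents (des, maj, imaj); the second row lists the descents of the
-- inverse from right to left.
exponents : Vec Step m → Monomial
exponents w = total (const 1) (proj₁ ∘ lookup w)
            , total (suc ∘ toℕ) (proj₁ ∘ lookup w)
            , total (suc ∘ toℕ) (proj₂ ∘ lookup w ∘ opposite)

des≡total : (σ : Permutation′ (suc m)) → des σ ≡ total (const 1) (descent σ)
des≡total {m} σ = trans (length≡sum (Des σ))
  (cong (sum ∘ map (const 1))
        (filter≡filterᵇ (λ i → (σ ⟨$⟩ʳ suc i) Fin.<? (σ ⟨$⟩ʳ inject₁ i)) (allFin m)))

maj≡total : (σ : Permutation′ (suc m)) → maj σ ≡ total (suc ∘ toℕ) (descent σ)
maj≡total {m} σ = cong (sum ∘ map (suc ∘ toℕ))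
  (filter≡filterᵇ (λ i → (σ ⟨$⟩ʳ suc i) Fin.<? (σ ⟨$⟩ʳ inject₁ i)) (allFin m))

-- Negation of all bits.
complement : Vec Step m → Vec Step m
complement = Vec.map (λ (b , c) → not b , not c)

module _ (σ : Permutation′ (suc m)) where

  private
    fst-word : proj₁ ∘ lookup (word σ) ≗ descent σ
    fst-word i = cong proj₁ (Vec.lookup∘tabulate (step σ) i)

    snd-word : proj₂ ∘ lookup (word σ) ∘ opposite ≗ descent (flip σ)
    snd-word i = trans (cong proj₂ (Vec.lookup∘tabulate (step σ) (opposite i)))
                       (cong (descent (flip σ)) (Fin.opposite-involutive i))

    total-complement : (g : Fin m → ℕ) (f′ f f₀ : Fin m → Bool) → f′ ≗ not ∘ f → f ≗ f₀ →
                       total g f′ ≡ sum (map g (allFin m)) ∸ total g f₀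
    total-complement g f′ f f₀ f′≗ f≗ =
      trans (total-cong g (λ i → trans (f′≗ i) (cong not (f≗ i)))) (total-not g f₀)

  exponents-word : exponents (word σ) ≡ (des σ , maj σ , imaj σ)
  exponents-word = cong₂ _,_
    (trans (total-cong (const 1) fst-word) (sym (des≡total σ)))
    (cong₂ _,_
      (trans (total-cong (suc ∘ toℕ) fst-word) (sym (maj≡total σ)))
      (trans (total-cong (suc ∘ toℕ) snd-word) (sym (maj≡total (flip σ)))))

  exponents-complement : exponents (complement (word σ))
                       ≡ (m ∸ des σ , suc m C 2 ∸ maj σ , suc m C 2 ∸ imaj σ)
  exponents-complement = cong₂ _,_
    (trans (total-complement (const 1) _ _ _ fst-complement fst-word)
           (cong₂ _∸_ (sum-const-1 m) (sym (des≡total σ))))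
    (cong₂ _,_
      (trans (total-complement (suc ∘ toℕ) _ _ _ fst-complement fst-word)
             (cong₂ _∸_ (sum-positions m) (sym (maj≡total σ))))
      (trans (total-complement (suc ∘ toℕ) _ _ _ (snd-complement ∘ opposite) snd-word)
             (cong₂ _∸_ (sum-positions m) (sym (maj≡total (flip σ))))))
    where
    fst-complement : proj₁ ∘ lookup (complement (word σ)) ≗ not ∘ proj₁ ∘ lookup (word σ)
    fst-complement i = cong proj₁ (Vec.lookup-map i _ (word σ))
    snd-complement : proj₂ ∘ lookup (complement (word σ)) ≗ not ∘ proj₂ ∘ lookup (word σ)
    snd-complement i = cong proj₂ (Vec.lookup-map i _ (word σ))

-- Sums of monomials

monomial : Monomial → Polynomial
monomial e = (1ℤ , e) ∷ []

powers : ∀ i j k → a ^ i * q ^ j * t ^ k ≡ monomial (i , j , k)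
powers i j k = begin
  a ^ i * q ^ j * t ^ k
    ≡⟨ cong₂ _*_ (cong₂ _*_ (power-a i) (power-q j)) (power-t k) ⟩
  monomial (i ℕ.+ 0 ℕ.+ 0 , j ℕ.+ 0 , k)
    ≡⟨ cong₂ (λ i j → monomial (i , j , k))
         (trans (ℕ.+-identityʳ _) (ℕ.+-identityʳ i)) (ℕ.+-identityʳ j) ⟩
  monomial (i , j , k) ∎
  where
  open ≡-Reasoning
  power-a : ∀ i → a ^ i ≡ monomial (i , 0 , 0)
  power-a zero    = refl
  power-a (suc i) = cong (a *_) (power-a i)
  power-q : ∀ i → q ^ i ≡ monomial (0 , i , 0)
  power-q zero    = refl
  power-q (suc i) = cong (q *_) (power-q i)
  power-t : ∀ i → t ^ i ≡ monomial (0 , 0 , i)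
  power-t zero    = refl
  power-t (suc i) = cong (t *_) (power-t i)

∑-monomials : {A : Set} {f : A → Polynomial} {g : A → Monomial} →
              (∀ x → f x ≡ monomial (g x)) → ∀ xs → ∑ xs f ≡ map (1ℤ ,_) (map g xs)
∑-monomials         f≡ []       = refl
∑-monomials {g = g} f≡ (x ∷ xs) = cong₂ _+_ (f≡ x) (∑-monomials f≡ xs)

coeff-++ : ∀ p r e → coeff (p ++ r) e ≡ coeff p e ℤ.+ coeff r e
coeff-++ []             r e = sym (ℤ.+-identityˡ _)
coeff-++ ((c , e′) ∷ p) r e with e′ ≟ₘ e
... | yes _ = trans (cong (λ d → c ℤ.+ d) (coeff-++ p r e)) (sym (ℤ.+-assoc c _ _))
... | no  _ = coeff-++ p r e

↭⇒≈ : {p r : Polynomial} → p ↭ r → p ≈ r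
↭⇒≈ ↭.refl e = refl
↭⇒≈ {p = _ ∷ p} {_ ∷ r} (↭.prep x p↭r) e = begin
  coeff (x ∷ p) e                      ≡⟨ coeff-++ (x ∷ []) p e ⟩
  coeff (x ∷ []) e ℤ.+ coeff p e       ≡⟨ cong (λ d → coeff (x ∷ []) e ℤ.+ d) (↭⇒≈ p↭r e) ⟩
  coeff (x ∷ []) e ℤ.+ coeff r e       ≡⟨ coeff-++ (x ∷ []) r e ⟨
  coeff (x ∷ r) e                      ∎
  where open ≡-Reasoning
↭⇒≈ {p = _ ∷ _ ∷ p} {_ ∷ _ ∷ r} (↭.swap x y p↭r) e = begin
  coeff ((x ∷ y ∷ []) ++ p) e          ≡⟨ coeff-++ (x ∷ y ∷ []) p e ⟩
  coeff (x ∷ y ∷ []) e ℤ.+ coeff p e   ≡⟨ cong₂ ℤ._+_ swapped (↭⇒≈ p↭r e) ⟩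
  coeff (y ∷ x ∷ []) e ℤ.+ coeff r e   ≡⟨ coeff-++ (y ∷ x ∷ []) r e ⟨
  coeff ((y ∷ x ∷ []) ++ r) e          ∎
  where
  open ≡-Reasoning
  swapped : coeff (x ∷ y ∷ []) e ≡ coeff (y ∷ x ∷ []) e
  swapped = trans (coeff-++ (x ∷ []) (y ∷ []) e)
    (trans (ℤ.+-comm (coeff (x ∷ []) e) _) (sym (coeff-++ (y ∷ []) (x ∷ []) e)))
↭⇒≈ (↭.trans p↭s s↭r) e = trans (↭⇒≈ p↭s e) (↭⇒≈ s↭r e)

-- The words of all 132-avoiding and of all 213-avoiding permutations

permutationSetoid : ℕ → Setoid _ _
permutationSetoid n = record
  { Carrier       = Permutation′ n
  ; _≈_           = Perm._≈_
  ; isEquivalence = record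
    { refl  = λ _ → refl
    ; sym   = λ eq i → sym (eq i)
    ; trans = λ eq eq′ i → trans (eq i) (eq′ i)
    }
  }

AllPairs-restrict : {A : Set} {P : A → Set} {R S : A → A → Set} →
                    (∀ {x y} → P x → P y → R x y → S x y) →
                    ∀ {xs} → All P xs → AllPairs R xs → AllPairs S xs
AllPairs-restrict f All.[]         []         = []
AllPairs-restrict f (px All.∷ pxs) (rx ∷ rxs) =
  All.zipWith (λ (py , r) → f px py r) (pxs , rx) ∷ AllPairs-restrict f pxs rxs

module _ {A : Set} {P : Permutation′ n → Set} (P? : Decidable P)
         (P-resp : ∀ σ τ → σ Perm.≈ τ → P σ → P τ)
         {f : Permutation′ n → A} (f-cong : ∀ σ τ → σ Perm.≈ τ → f σ ≡ f τ) where

  images-unique : (∀ σ τ → P σ → P τ → f σ ≡ f τ → σ Perm.≈ τ) →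
                  Unique (map f (filter P? (permutations n)))
  images-unique f-injective = AllPairs.map⁺
    (AllPairs-restrict (λ {σ} {τ} pσ pτ σ≉τ eq → σ≉τ (f-injective σ τ pσ pτ eq))
      (All.all-filter P? (permutations n))
      (AllPairs.filter⁺ P? (permutations-unique n)))

  ∈-images : ∀ {w} → w ∈ map f (filter P? (permutations n)) ⇔ (∃[ σ ] P σ × f σ ≡ w)
  ∈-images {w} = mk⇔ to from
    where
    resp : P Respects Perm._≈_
    resp {σ} {τ} = P-resp σ τ
    to : w ∈ map f (filter P? (permutations n)) → ∃[ σ ] P σ × f σ ≡ w
    to w∈ with σ , _ , w≡ , pσ ← ∈-map∘filter⁻ (permutationSetoid n) (≡.setoid A) P? resp
                                   {xs = permutations n} w∈ = σ , pσ , sym w≡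
    from : (∃[ σ ] P σ × f σ ≡ w) → w ∈ map f (filter P? (permutations n))
    from (σ , pσ , eq) = ∈-map∘filter⁺ (permutationSetoid n) (≡.setoid A) P? resp
      (λ {σ} {τ} → f-cong σ τ) (σ , permutations-complete σ , sym eq , pσ)

dual-involutive : (w : Vec Step m) → Vec.map dual (Vec.map dual w) ≡ w
dual-involutive w = begin
  Vec.map dual (Vec.map dual w)
    ≡⟨ Vec.map-∘ dual dual w ⟨
  Vec.map (dual ∘ dual) w
    ≡⟨ Vec.map-cong (λ (b , c) → cong₂ _,_ (Bool.not-involutive b) (Bool.not-involutive c)) w ⟩
  Vec.map id w
    ≡⟨ Vec.map-id w ⟩
  w ∎
  where open ≡-Reasoning

dual-antitranspose : (σ : Permutation′ (suc m)) →
                     Vec.map dual (word (antitranspose σ)) ≡ complement (word σ)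
dual-antitranspose σ =
  trans (cong (Vec.map dual) (word-antitranspose σ)) (sym (Vec.map-∘ dual swap (word σ)))

avoids213⇒132 : (σ : Permutation′ n) → ¬ Contains213 σ → ¬ Contains132 (antitranspose σ)
avoids213⇒132 σ avoids c =
  avoids (contains213-cong (antitranspose (antitranspose σ)) σ (antitranspose-involutive σ)
    (contains132⇒213 (antitranspose σ) c))

avoids132⇒213 : (σ : Permutation′ n) → ¬ Contains132 σ → ¬ Contains213 (antitranspose σ)
avoids132⇒213 σ avoids c =
  avoids (contains132-cong (antitranspose (antitranspose σ)) σ (antitranspose-involutive σ)
    (contains213⇒132 (antitranspose σ) c))

complement-word-cong : (σ τ : Permutation′ (suc m)) → σ Perm.≈ τ →
                  complement (word σ) ≡ complement (word τ)
complement-word-cong σ τ eq = cong complement (word-cong σ τ eq)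

words-132 : {w : Vec Step m} → (∃[ σ ] ¬ Contains132 σ × word σ ≡ w) ⇔ Path 0 w
words-132 = mk⇔ (λ { (σ , avoids , refl) → word-path σ avoids }) word-surjective

words-213 : {w : Vec Step m} → (∃[ σ ] ¬ Contains213 σ × complement (word σ) ≡ w) ⇔ Path 0 w
words-213 {m} {w} = mk⇔ to from
  where
  to : (∃[ σ ] ¬ Contains213 σ × complement (word σ) ≡ w) → Path 0 w
  to (σ , avoids , refl) = subst (Path 0) (dual-antitranspose σ)
    (path-dual (word-path (antitranspose σ) (avoids213⇒132 σ avoids)))
  from : Path 0 w → ∃[ σ ] ¬ Contains213 σ × complement (word σ) ≡ w
  from p with σ , avoids , eq ← word-surjective (path-dual p) =
    antitranspose σ , avoids132⇒213 σ avoids , (begin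
      complement (word (antitranspose σ))
        ≡⟨ dual-antitranspose (antitranspose σ) ⟨
      Vec.map dual (word (antitranspose (antitranspose σ)))
        ≡⟨ cong (Vec.map dual)
             (word-cong (antitranspose (antitranspose σ)) σ (antitranspose-involutive σ)) ⟩
      Vec.map dual (word σ)
        ≡⟨ cong (Vec.map dual) eq ⟩
      Vec.map dual (Vec.map dual w)
        ≡⟨ dual-involutive w ⟩
      w ∎)
    where open ≡-Reasoning

complement-word-injective : (σ τ : Permutation′ (suc m)) → ¬ Contains213 σ → ¬ Contains213 τ →
                       complement (word σ) ≡ complement (word τ) → σ Perm.≈ τ
complement-word-injective σ τ avoids-σ avoids-τ eq x = begin
  σ ⟨$⟩ʳ x
    ≡⟨ antitranspose-involutive σ x ⟨
  antitranspose (antitranspose σ) ⟨$⟩ʳ x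
    ≡⟨ antitranspose-cong (antitranspose σ) (antitranspose τ) images x ⟩
  antitranspose (antitranspose τ) ⟨$⟩ʳ x
    ≡⟨ antitranspose-involutive τ x ⟩
  τ ⟨$⟩ʳ x ∎
  where
  open ≡-Reasoning
  images : antitranspose σ Perm.≈ antitranspose τ
  images = word-injective (antitranspose σ) (antitranspose τ)
    (avoids213⇒132 σ avoids-σ) (avoids213⇒132 τ avoids-τ) (begin
      word (antitranspose σ)
        ≡⟨ dual-involutive _ ⟨
      Vec.map dual (Vec.map dual (word (antitranspose σ)))
        ≡⟨ cong (Vec.map dual)
             (trans (dual-antitranspose σ) (trans eq (sym (dual-antitranspose τ)))) ⟩
      Vec.map dual (Vec.map dual (word (antitranspose τ)))
        ≡⟨ dual-involutive _ ⟩
      word (antitranspose τ) ∎)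

words-↭ : ∀ m → map word (𝒮₁₃₂ (suc m)) ↭ map (complement ∘ word) (𝒮₂₁₃ (suc m))
words-↭ m = ∼bag⇒↭ (unique∧set⇒bag
  (images-unique avoids132? resp132 word-cong word-injective)
  (images-unique avoids213? resp213 complement-word-cong complement-word-injective)
  (λ {w} → ⇔-trans (∈-images avoids132? resp132 word-cong)
          (⇔-trans words-132
          (⇔-trans (⇔-sym words-213)
          (⇔-sym (∈-images avoids213? resp213 complement-word-cong))))))
  where
  resp132 : (σ τ : Permutation′ (suc m)) → σ Perm.≈ τ → ¬ Contains132 σ → ¬ Contains132 τ
  resp132 σ τ eq avoids c = avoids (contains132-cong τ σ (λ i → sym (eq i)) c)
  resp213 : (σ τ : Permutation′ (suc m)) → σ Perm.≈ τ → ¬ Contains213 σ → ¬ Contains213 τ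
  resp213 σ τ eq avoids c = avoids (contains213-cong τ σ (λ i → sym (eq i)) c)

theorem5p8 : ∀ (n : ℕ) → n ≥ 1 →
    ∑ (𝒮₁₃₂ n) (λ σ → a ^ des σ * q ^ maj σ * t ^ imaj σ)
    ≈ ∑ (𝒮₂₁₃ n) (λ σ → a ^ (n ∸ 1 ∸ des σ) * q ^ (n C 2 ∸ maj σ) * t ^ (n C 2 ∸ imaj σ))
theorem5p8 (suc m) _ =
  subst₂ _≈_ (sym (total-terms 132-term (𝒮₁₃₂ (suc m)))) (sym (total-terms 213-term (𝒮₂₁₃ (suc m))))
    (↭⇒≈ (↭-map⁺ (1ℤ ,_) (↭-map⁺ exponents (words-↭ m))))
  where
  132-term : (σ : Permutation′ (suc m)) →
             a ^ des σ * q ^ maj σ * t ^ imaj σ ≡ monomial (exponents (word σ))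
  132-term σ = trans (powers (des σ) (maj σ) (imaj σ)) (cong monomial (sym (exponents-word σ)))
  213-term : (σ : Permutation′ (suc m)) →
             a ^ (m ∸ des σ) * q ^ (suc m C 2 ∸ maj σ) * t ^ (suc m C 2 ∸ imaj σ)
             ≡ monomial (exponents (complement (word σ)))
  213-term σ = trans (powers (m ∸ des σ) (suc m C 2 ∸ maj σ) (suc m C 2 ∸ imaj σ))
    (cong monomial (sym (exponents-complement σ)))
  total-terms : {f : Permutation′ (suc m) → Polynomial} {g : Permutation′ (suc m) → Vec Step m} →
                (∀ σ → f σ ≡ monomial (exponents (g σ))) → ∀ σs →
                ∑ σs f ≡ map (1ℤ ,_) (map exponents (map g σs))
  total-terms f≡ σs = trans (∑-monomials f≡ σs) (cong (map (1ℤ ,_)) (List.map-∘ σs))
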